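{- Let $\epsilon>0$ and let $\mathcal{H}=(V,\mathcal{E},f)$ be an edge-weighted hypergraph of rank $r$ with $n=|V|$ such that for every $e\in\mathcal{E}$ the edge-weight function $f_e$ is non-decreasing and convex with $f_e(0)=0$. Then the algorithm GDSH-Para is a $\frac{1}{r(1+\epsilon)}$-approximation algorithm for GDSH, i.e. the set $S'$ it returns satisfies \[ \frac{F(S')}{|S'|}\ \ge\ \frac{1}{r(1+\epsilon)}\max_{\emptyset\ne T\subseteq V}\frac{F(T)}{|T|}, \] and it terminates after $O(\log_{1+\epsilon}n)$ iterations.
   Context: An edge-weighted hypergraph $\mathcal{H}=(V,\mathcal{E},f)$ consists of a finite nonempty vertex set $V$, a finite nonempty set $\mathcal{E}$ of nonempty subsets of $V$ (hyperedges), and for each $e\in\mathcal{E}$ an edge-weight function $f_e:\{0,\dots,|e|\}\to\mathbb{R}_{\ge 0}$. Its rank is $r=\max_{e\in\mathcal{E}}|e|$. The function $f_e$ is non-decreasing if $f_e(i)\le f_e(i+1)$ for all $i\in\{0,\dots,|e|-1\}$, and convex if $f_e(i)-f_e(i-1)\le f_e(i+1)-f_e(i)$ for all $i\in\{1,\dots,|e|-1\}$. For $S\subseteq V$, $F(S)=\sum_{e\in\mathcal{E}}f_e(|e\cap S|)$. The generalized densest sub-hypergraph problem (GDSH) asks for a nonempty $S\subseteq V$ maximizing $F(S)/|S|$. Algorithm GDSH-Para (with parameter $\epsilon$): start with $S\leftarrow V$, $S'\leftarrow V$. While $S\ne\emptyset$ (each pass through the loop is one iteration): let $\Delta\leftarrow\{v\in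 S: F(S)-F(S\setminus\{v\})\le r(1+\epsilon)\frac{F(S)}{|S|}\}$; set $S\leftarrow S\setminus\Delta$; if $S\ne\emptyset$ and $\frac{F(S)}{|S|}>\frac{F(S')}{|S'|}$, set $S'\leftarrow S$. Return $S'$. -}

module Defs where

open import Algebra.Bundles using (CommutativeRing; Semiring)
import Algebra.Definitions.RawSemiring as RawSemiringDefs
import Algebra.Properties.Monoid.Mult as MonoidMult
import Algebra.Properties.Ring as RingProperties
import Algebra.Properties.Semiring.Exp as SemiringExp
open import Data.Bool.Base using (if_then_else_)
open import Data.Fin.Base using (Fin; toℕ; fromℕ<)
open import Data.Fin.Subset
  using (Subset; Nonempty; Empty; ⊤; _∩_; _─_; ∣_∣)
  renaming (_-_ to infixl 6 _∖_)
open import Data.Fin.Subset.Properties using (_∈?_; nonempty?; ∣p∩q∣≤∣p∣)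
open import Data.Nat.Base as ℕ using (ℕ; suc; NonZero; s≤s)
import Data.Nat.Properties as ℕ
open import Data.Product.Base using (∃; ∃₂; _×_; _,_; proj₁; proj₂)
open import Data.Sum.Base using (inj₁; inj₂)
import Data.Vec.Base as Vec
import Data.Vec.Functional as Vector
open import Function.Definitions using (Injective)
open import Level using (Level; _⊔_) renaming (suc to lsuc)
open import Relation.Binary.Bundles using (DecTotalOrder)
open import Relation.Binary.Core using (Rel)
open import Relation.Binary.PropositionalEquality.Core using (_≡_)
open import Relation.Binary.Structures using (IsDecTotalOrder)
import Relation.Binary.Construct.NonStrictToStrict as NonStrictToStrict
import Relation.Binary.Properties.DecTotalOrder as DecTotalOrderProperties
open import Relation.Nullary.Decidable.Core
  using (Dec; does; yes; no; _×-dec_)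
open import Relation.Nullary.Negation.Core using (¬_; contradiction)
open import Relation.Unary using (Pred)

-- The axioms of the real numbers.  Classically ℝ is the only model up to
-- isomorphism; decidability of the order and the Archimedean property,
-- which classical logic provides for ℝ, are listed because they cannot be
-- derived constructively from the other axioms.

record CompleteOrderedField (c ℓ₁ ℓ₂ : Level) : Set (lsuc (c ⊔ ℓ₁ ⊔ ℓ₂)) where
  field
    commutativeRing : CommutativeRing c ℓ₁

  open CommutativeRing commutativeRing public
    renaming (_-_ to infixl 6 _-_)
  open RawSemiringDefs (Semiring.rawSemiring semiring) public using (_^_; sum)

  infix  4 _≤_
  infix  8 _⁻¹
  infixl 7 _/_

  field
    _≤_             : Rel Carrier ℓ₂
    isDecTotalOrder : IsDecTotalOrder _≈_ _≤_
    +-monoˡ-≤       : ∀ z {x y} → x ≤ y → x + z ≤ y + z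
    *-nonNeg        : ∀ {x y} → 0# ≤ x → 0# ≤ y → 0# ≤ x * y
    0≉1             : ¬ (0# ≈ 1#)
    -- Total, with an unspecified value at 0.
    _⁻¹             : Carrier → Carrier
    *-inverseʳ      : ∀ {x} → ¬ (x ≈ 0#) → x * x ⁻¹ ≈ 1#

  decTotalOrder : DecTotalOrder c ℓ₁ ℓ₂
  decTotalOrder = record { isDecTotalOrder = isDecTotalOrder }

  open IsDecTotalOrder isDecTotalOrder public
    using (_≟_; _≤?_; antisym; total; ≤-respˡ-≈; ≤-respʳ-≈)
    renaming (refl to ≤-refl; reflexive to ≤-reflexive; trans to ≤-trans)
  open NonStrictToStrict _≈_ _≤_ public using (_<_)

  infix 4 _<?_

  _<?_ : ∀ x y → Dec (x < y)
  _<?_ = NonStrictToStrict.<-decidable _≈_ _≤_ _≟_ _≤?_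

  _/_ : Carrier → Carrier → Carrier
  x / y = x * y ⁻¹

  fromℕ : ℕ → Carrier
  fromℕ k = RawSemiringDefs._×_ (Semiring.rawSemiring semiring) k 1#

  IsUpperBound : ∀ {p} → Pred Carrier p → Pred Carrier (c ⊔ p ⊔ ℓ₂)
  IsUpperBound P u = ∀ {x} → P x → x ≤ u

  IsSupremum : ∀ {p} → Pred Carrier p → Pred Carrier (c ⊔ p ⊔ ℓ₂)
  IsSupremum P s = IsUpperBound P s × (∀ {u} → IsUpperBound P u → s ≤ u)

  field
    archimedean  : ∀ x → ∃ λ k → x ≤ fromℕ k
    completeness : (P : Pred Carrier (ℓ₁ ⊔ ℓ₂)) →
                   ∃ P → ∃ (IsUpperBound P) → ∃ (IsSupremum P)

module Logarithm {c ℓ₁ ℓ₂ : Level} (ℝ : CompleteOrderedField c ℓ₁ ℓ₂) where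

  open CompleteOrderedField ℝ
  open RingProperties ring using (-‿distribˡ-*; -‿distribʳ-*; -‿involutive)
  open SemiringExp semiring using (^-homo-*; ^-assocʳ)
  open MonoidMult +-monoid using (×-homo-+)
  open DecTotalOrderProperties decTotalOrder using (<⇒≱; ≰⇒≥)

  private
    +-monoʳ-≤ : ∀ z {x y} → x ≤ y → z + x ≤ z + y
    +-monoʳ-≤ z x≤y =
      ≤-respˡ-≈ (+-comm _ z) (≤-respʳ-≈ (+-comm _ z) (+-monoˡ-≤ z x≤y))

    +-mono-≤ : ∀ {w x y z} → w ≤ x → y ≤ z → w + y ≤ x + z
    +-mono-≤ {x = x} {y} w≤x y≤z = ≤-trans (+-monoˡ-≤ y w≤x) (+-monoʳ-≤ x y≤z)

    x-y+y≈x : ∀ x y → x - y + y ≈ x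
    x-y+y≈x x y =
      trans (+-assoc x (- y) y) (trans (+-congˡ (-‿inverseˡ y)) (+-identityʳ x))

    x≤y⇒0≤y-x : ∀ {x y} → x ≤ y → 0# ≤ y - x
    x≤y⇒0≤y-x {x} x≤y = ≤-respˡ-≈ (-‿inverseʳ x) (+-monoˡ-≤ (- x) x≤y)

    0≤y-x⇒x≤y : ∀ {x y} → 0# ≤ y - x → x ≤ y
    0≤y-x⇒x≤y {x} {y} p =
      ≤-respˡ-≈ (+-identityˡ x) (≤-respʳ-≈ (x-y+y≈x y x) (+-monoˡ-≤ x p))

    *-monoˡ-≤ : ∀ {x y z} → 0# ≤ z → x ≤ y → x * z ≤ y * z
    *-monoˡ-≤ {x} {y} {z} 0≤z x≤y = 0≤y-x⇒x≤y (≤-respʳ-≈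
      (trans (distribʳ z y (- x)) (+-congˡ (sym (-‿distribˡ-* x z))))
      (*-nonNeg (x≤y⇒0≤y-x x≤y) 0≤z))

    *-monoʳ-≤ : ∀ {x y z} → 0# ≤ z → x ≤ y → z * x ≤ z * y
    *-monoʳ-≤ {z = z} 0≤z x≤y =
      ≤-respˡ-≈ (*-comm _ z) (≤-respʳ-≈ (*-comm _ z) (*-monoˡ-≤ 0≤z x≤y))

    *-mono-≤ : ∀ {w x y z} → 0# ≤ x → 0# ≤ y → w ≤ x → y ≤ z → w * y ≤ x * z
    *-mono-≤ 0≤x 0≤y w≤x y≤z = ≤-trans (*-monoˡ-≤ 0≤y w≤x) (*-monoʳ-≤ 0≤x y≤z)

    0≤1 : 0# ≤ 1#
    0≤1 with total 0# 1#
    ... | inj₁ p = p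
    ... | inj₂ p = ≤-respʳ-≈ -1*-1≈1 (*-nonNeg 0≤-1 0≤-1)
      where
      0≤-1 : 0# ≤ - 1#
      0≤-1 = ≤-respʳ-≈ (+-identityˡ (- 1#)) (x≤y⇒0≤y-x p)
      -1*-1≈1 : (- 1#) * (- 1#) ≈ 1#
      -1*-1≈1 = trans (sym (-‿distribˡ-* 1# (- 1#)))
        (trans (-‿cong (*-identityˡ (- 1#))) (-‿involutive 1#))

    0≤x² : ∀ x → 0# ≤ x * x
    0≤x² x with total 0# x
    ... | inj₁ p = *-nonNeg p p
    ... | inj₂ p = ≤-respʳ-≈ eq (*-nonNeg 0≤-x 0≤-x)
      where
      0≤-x : 0# ≤ - x
      0≤-x = ≤-respʳ-≈ (+-identityˡ (- x)) (x≤y⇒0≤y-x p)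
      eq : (- x) * (- x) ≈ x * x
      eq = trans (sym (-‿distribˡ-* x (- x)))
        (trans (-‿cong (sym (-‿distribʳ-* x x))) (-‿involutive (x * x)))

    -- x⁻¹ ≈ x * (x⁻¹ * x⁻¹)
    0≤x⁻¹ : ∀ {x} → 0# < x → 0# ≤ x ⁻¹
    0≤x⁻¹ {x} (0≤x , 0≉x) = ≤-respʳ-≈
      (trans (sym (*-assoc x _ _))
        (trans (*-congʳ (*-inverseʳ λ x≈0 → 0≉x (sym x≈0))) (*-identityˡ _)))
      (*-nonNeg 0≤x (0≤x² (x ⁻¹)))

    0≤fromℕ : ∀ k → 0# ≤ fromℕ k
    0≤fromℕ ℕ.zero = ≤-refl
    0≤fromℕ (suc k) = ≤-respˡ-≈ (+-identityˡ 0#) (+-mono-≤ 0≤1 (0≤fromℕ k))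

    fromℕ-mono : ∀ {j k} → j ℕ.≤ k → fromℕ j ≤ fromℕ k
    fromℕ-mono {k = k} ℕ.z≤n = 0≤fromℕ k
    fromℕ-mono (s≤s j≤k) = +-monoʳ-≤ 1# (fromℕ-mono j≤k)

    fromℕ-* : ∀ j k → fromℕ (j ℕ.* k) ≈ fromℕ j * fromℕ k
    fromℕ-* ℕ.zero k = sym (zeroˡ (fromℕ k))
    fromℕ-* (suc j) k = trans (×-homo-+ 1# k (j ℕ.* k))
      (trans (+-cong (sym (*-identityˡ (fromℕ k))) (fromℕ-* j k))
        (sym (distribʳ (fromℕ k) 1# (fromℕ j))))

  1≤fromℕ : ∀ k → .{{NonZero k}} → 1# ≤ fromℕ k
  1≤fromℕ (suc k) =
    ≤-respˡ-≈ (+-identityʳ 1#) (+-monoʳ-≤ 1# (0≤fromℕ k))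

  1<1+x : ∀ {x} → 0# < x → 1# < 1# + x
  1<1+x {x} (0≤x , 0≉x) =
      ≤-respˡ-≈ (+-identityʳ 1#) (+-monoʳ-≤ 1# 0≤x)
    , λ 1≈1+x → 0≉x (trans (sym (-‿inverseˡ 1#)) (trans (+-congˡ 1≈1+x)
        (trans (sym (+-assoc (- 1#) 1# x))
          (trans (+-congʳ (-‿inverseˡ 1#)) (+-identityˡ x)))))

  private
    0<fromℕ-suc : ∀ k → 0# < fromℕ (suc k)
    0<fromℕ-suc k = 0≤fromℕ (suc k) , λ 0≈k →
      0≉1 (antisym 0≤1 (≤-respʳ-≈ (sym 0≈k) (1≤fromℕ (suc k))))

    1≤x^ : ∀ {x} → 1# ≤ x → ∀ k → 1# ≤ x ^ k
    1≤x^ 1≤x ℕ.zero = ≤-refl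
    1≤x^ 1≤x (suc k) = ≤-respˡ-≈ (*-identityˡ 1#)
      (*-mono-≤ (≤-trans 0≤1 1≤x) 0≤1 1≤x (1≤x^ 1≤x k))

    ^-monoˡ-≤ : ∀ {x y} → 1# ≤ x → x ≤ y → ∀ k → x ^ k ≤ y ^ k
    ^-monoˡ-≤ 1≤x x≤y ℕ.zero = ≤-refl
    ^-monoˡ-≤ 1≤x x≤y (suc k) =
      *-mono-≤ (≤-trans 0≤1 (≤-trans 1≤x x≤y)) (≤-trans 0≤1 (1≤x^ 1≤x k))
        x≤y (^-monoˡ-≤ 1≤x x≤y k)

    ^-monoʳ-≤ : ∀ {x} → 1# ≤ x → ∀ {j k} → j ℕ.≤ k → x ^ j ≤ x ^ k
    ^-monoʳ-≤ 1≤x {k = k} ℕ.z≤n = 1≤x^ 1≤x k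
    ^-monoʳ-≤ 1≤x (s≤s j≤k) = *-monoʳ-≤ (≤-trans 0≤1 1≤x) (^-monoʳ-≤ 1≤x j≤k)

    -- If k < j, cancelling x ^ k in x * x ^ k ≤ x ^ j ≤ x ^ k gives x ≤ 1.
    ^-cancelʳ-≤ : ∀ {x} → 1# < x → ∀ {j k} → x ^ j ≤ x ^ k → j ℕ.≤ k
    ^-cancelʳ-≤ {x} 1<x@(1≤x , _) {j} {k} xʲ≤xᵏ with j ℕ.≤? k
    ... | yes j≤k = j≤k
    ... | no  j≰k = contradiction x≤1 (<⇒≱ 1<x)
      where
      0≤xᵏ : 0# ≤ x ^ k
      0≤xᵏ = ≤-trans 0≤1 (1≤x^ 1≤x k)
      step : x * x ^ k ≤ x ^ k
      step = ≤-trans (^-monoʳ-≤ 1≤x (ℕ.≰⇒> j≰k)) xʲ≤xᵏ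
      xᵏ≉0 : ¬ (x ^ k ≈ 0#)
      xᵏ≉0 e = 0≉1 (antisym 0≤1 (≤-respʳ-≈ e (1≤x^ 1≤x k)))
      cancel : ∀ y → y * x ^ k * (x ^ k) ⁻¹ ≈ y
      cancel y = trans (*-assoc y _ _)
        (trans (*-congˡ (*-inverseʳ xᵏ≉0)) (*-identityʳ y))
      x≤1 : x ≤ 1#
      x≤1 = ≤-respˡ-≈ (cancel x) (≤-respʳ-≈ (cancel 1#)
        (*-monoˡ-≤ (0≤x⁻¹ (0≤xᵏ , λ e → xᵏ≉0 (sym e)))
          (≤-respʳ-≈ (sym (*-identityˡ (x ^ k))) step)))

    bernoulli : ∀ {x} → 1# ≤ x → ∀ k → 1# + fromℕ k * (x - 1#) ≤ x ^ k
    bernoulli {x} 1≤x ℕ.zero =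
      ≤-reflexive (trans (+-congˡ (zeroˡ _)) (+-identityʳ 1#))
    bernoulli {x} 1≤x (suc k) = ≤-respʳ-≈ rhs (≤-respˡ-≈ lhs
      (+-mono-≤ (bernoulli 1≤x k)
        (*-monoˡ-≤ (x≤y⇒0≤y-x 1≤x) (1≤x^ 1≤x k))))
      where
      d = x - 1#
      lhs : 1# + fromℕ k * d + 1# * d ≈ 1# + fromℕ (suc k) * d
      lhs = trans (+-assoc _ _ _) (+-congˡ
        (trans (+-comm _ _) (sym (distribʳ d 1# (fromℕ k)))))
      rhs : x ^ k + x ^ k * d ≈ x ^ suc k
      rhs = trans (+-congʳ (sym (*-identityʳ (x ^ k))))
        (trans (sym (distribˡ (x ^ k) 1# d)) (trans (*-comm _ _)
          (*-congʳ (trans (+-comm 1# d) (x-y+y≈x x 1#)))))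

    ^-unbounded : ∀ {x} → 1# < x → ∀ y → ∃ λ k → y ≤ x ^ k
    ^-unbounded {x} (1≤x , 1≉x) y with archimedean (y / (x - 1#))
    ... | k , y/d≤k = k , ≤-trans (≤-respˡ-≈ cancel (*-monoˡ-≤ 0≤d y/d≤k))
      (≤-trans (≤-respˡ-≈ (+-identityˡ _) (+-monoˡ-≤ _ 0≤1)) (bernoulli 1≤x k))
      where
      d = x - 1#
      0≤d : 0# ≤ d
      0≤d = x≤y⇒0≤y-x 1≤x
      d≉0 : ¬ (d ≈ 0#)
      d≉0 e = 1≉x (trans (sym (+-identityˡ 1#))
        (trans (+-congʳ (sym e)) (x-y+y≈x x 1#)))
      cancel : y / d * d ≈ y
      cancel = trans (*-assoc y _ _) (trans (*-congˡ
        (trans (*-comm _ d) (*-inverseʳ d≉0))) (*-identityʳ y))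

  -- The rationals p / q ≥ 0 (with q = 1 + q′) such that b ^ (p / q) ≤ y.
  -- For b > 1 and y ≥ 1 their supremum is the logarithm of y to base b.
  RationalBelowLog : (b y : Carrier) → Pred Carrier (ℓ₁ ⊔ ℓ₂)
  RationalBelowLog b y x = ∃₂ λ p q′ →
    x ≈ fromℕ p / fromℕ (suc q′) × b ^ p ≤ y ^ suc q′

  log-supremum : ∀ b y → 1# < b → 1# ≤ y → ∃ (IsSupremum (RationalBelowLog b y))
  log-supremum b y 1<b@(1≤b , _) 1≤y = completeness (RationalBelowLog b y)
    (_ , 0 , 0 , refl , 1≤x^ 1≤y 1) (fromℕ k , bound)
    where
    k = proj₁ (^-unbounded 1<b y)
    y≤bᵏ = proj₂ (^-unbounded 1<b y)
    bound : IsUpperBound (RationalBelowLog b y) (fromℕ k)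
    bound (p , q′ , x≈p/q , bᵖ≤y^q) = ≤-respˡ-≈ (sym x≈p/q) (≤-respʳ-≈ kq/q≈k
      (*-monoˡ-≤ (0≤x⁻¹ (0<fromℕ-suc q′))
        (≤-respʳ-≈ (fromℕ-* k q) (fromℕ-mono p≤kq))))
      where
      q = suc q′
      p≤kq : p ℕ.≤ k ℕ.* q
      p≤kq = ^-cancelʳ-≤ 1<b (≤-trans bᵖ≤y^q
        (≤-respʳ-≈ (^-assocʳ b k q) (^-monoˡ-≤ 1≤y y≤bᵏ q)))
      kq/q≈k : fromℕ k * fromℕ q / fromℕ q ≈ fromℕ k
      kq/q≈k = trans (*-assoc _ _ _) (trans (*-congˡ
        (*-inverseʳ λ e → proj₂ (0<fromℕ-suc q′) (sym e))) (*-identityʳ _))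

  log : ∀ b y → 1# < b → 1# ≤ y → Carrier
  log b y 1<b 1≤y = proj₁ (log-supremum b y 1<b 1≤y)

module DensestSubhypergraph
  {c ℓ₁ ℓ₂ : Level} (ℝ : CompleteOrderedField c ℓ₁ ℓ₂) where

  open CompleteOrderedField ℝ

  -- The vertex set is Fin n; injectivity makes the hyperedges a set.
  record Hypergraph (n : ℕ) : Set (c ⊔ ℓ₂) where
    field
      {{vertices-nonZero}} : NonZero n
      size                 : ℕ
      {{size-nonZero}}     : NonZero size
      edge                 : Fin size → Subset n
      edge-injective       : Injective _≡_ _≡_ edge
      edge-nonempty        : ∀ e → Nonempty (edge e)
      weight               : ∀ e → Fin (suc ∣ edge e ∣) → Carrier
      weight-nonNeg        : ∀ e i → 0# ≤ weight e i

  NonDecreasing : ∀ {k} → (Fin (suc k) → Carrier) → Set ℓ₂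
  NonDecreasing f = ∀ i j → toℕ j ≡ suc (toℕ i) → f i ≤ f j

  -- i, j and k are consecutive.
  Convex : ∀ {k} → (Fin (suc k) → Carrier) → Set ℓ₂
  Convex f = ∀ i j k → toℕ j ≡ suc (toℕ i) → toℕ k ≡ suc (toℕ j) →
    f j - f i ≤ f k - f j

  module _ {n : ℕ} (H : Hypergraph n) where

    open Hypergraph H

    rank : ℕ
    rank = Vector.foldr ℕ._⊔_ 0 (λ e → ∣ edge e ∣)

    F : Subset n → Carrier
    F S = sum λ e → weight e (fromℕ< (s≤s (∣p∩q∣≤∣p∣ (edge e) S)))

    -- Only meaningful for nonempty S.
    density : Subset n → Carrier
    density S = F S / fromℕ ∣ S ∣

    Optimal : Subset n → Set ℓ₂
    Optimal S = Nonempty S × (∀ T → Nonempty T → density T ≤ density S)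

    module GDSH-Para (ε : Carrier) where

      Removable : Subset n → Fin n → Set ℓ₂
      Removable S v =
        F S - F (S ∖ v) ≤ fromℕ rank * (1# + ε) * density S

      removable? : ∀ S v → Dec (Removable S v)
      removable? S v = F S - F (S ∖ v) ≤? fromℕ rank * (1# + ε) * density S

      Δ : Subset n → Subset n
      Δ S = Vec.tabulate λ v → does (v ∈? S ×-dec removable? S v)

      best : Subset n → Subset n → Subset n
      best S S′ =
        if does (nonempty? S ×-dec (density S′ <? density S)) then S else S′

      -- Run S S′ t R: the loop entered in state (S , S′) exits after exactly
      -- t iterations and returns R.
      data Run : Subset n → Subset n → ℕ → Subset n → Set where
        exit : ∀ {S S′} → Empty S → Run S S′ 0 S′
        iter : ∀ {S S′ t R} → Nonempty S →
               Run (S ─ Δ S) (best (S ─ Δ S) S′) t R → Run S S′ (suc t) R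

      Returns_After_ : Subset n → ℕ → Set
      Returns R After t = Run ⊤ ⊤ t R

{-# OPTIONS --safe #-}
module Submission where

-- Summing the marginals F(S) − F(S∖v) over v ∈ T counts each edge e at most |e ∩ T| ≤ r times, each
-- time with at most f_e(|e ∩ S|), so they total at most r F(S).  The vertices surviving a round have
-- marginals above r(1+ε) F(S)/|S|, hence |S| shrinks by the factor 1+ε in every round.
-- If T is optimal, removing a vertex of T costs at least F(T)/|T|, and by convexity it costs no less
-- in any S ⊇ T.  When a vertex of T is first deleted, its marginal in S is at most r(1+ε) F(S)/|S|.

open import Defs
import Algebra.Properties.AbelianGroup as AbelianGroupProperties
import Algebra.Properties.Ring as RingProperties
import Algebra.Properties.Semiring.Sum as SemiringSum
import Algebra.Solver.Ring.NaturalCoefficients.Default as SemiringSolver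
open import Data.Bool.Base using (true; if_then_else_)
open import Data.Fin.Base as Fin using (Fin; toℕ; inject₁)
open import Data.Fin.Properties using (toℕ-fromℕ<; toℕ-inject₁; toℕ-injective)
open import Data.Fin.Subset
  using (Subset; Nonempty; _∈_; _∉_; _⊆_; ⊤; ⊥; _∩_; _─_; ∣_∣; inside; outside)
  renaming (_-_ to infixl 6 _∖_)
open import Data.Fin.Subset.Properties
open import Data.Nat.Base as ℕ using (ℕ; zero; suc; z≤n; s≤s; NonZero)
open import Data.Nat.Induction using (<-wellFounded)
import Data.Nat.Properties as ℕ
open import Data.Product.Base using (∃; ∃₂; ∃-syntax; _×_; _,_; proj₁; proj₂)
open import Data.Sum.Base using (inj₁; inj₂)
open import Data.Vec.Base as Vec using ([]; _∷_; here; there)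
open import Data.Vec.Properties using ([]=⇒lookup; lookup⇒[]=; lookup∘tabulate)
import Data.Vec.Functional as Vector
open import Function.Base using (_∘_)
open import Induction.WellFounded using (Acc; acc)
open import Level using (Level)
open import Relation.Binary.Bundles using (DecTotalOrder)
import Relation.Binary.Construct.NonStrictToStrict as NonStrictToStrict
import Relation.Binary.Properties.DecTotalOrder as DecTotalOrderProperties
open import Relation.Binary.PropositionalEquality.Core as ≡ using (_≡_; refl; cong; subst)
import Relation.Binary.Reasoning.PartialOrder as PartialOrderReasoning
open import Relation.Nullary.Decidable.Core using (Dec; yes; no; does; _×-dec_)
open import Relation.Nullary.Decidable using (dec-true)
open import Relation.Nullary.Negation.Core using (¬_; contradiction)

-- Decisions and finite subsets.

private
  variable
    a p : Level
    n : ℕ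

-- Moves a case split under a predicate, so that properties of an `if does` term such as `best`
-- follow from its two branches.
if-does-elim : {A : Set a} {B : Set p} {ℓ : Level} (P : B → Set ℓ) (A? : Dec A) {x y : B} →
               (A → P x) → (¬ A → P y) → P (if does A? then x else y)
if-does-elim P (yes a) Px Py = Px a
if-does-elim P (no ¬a) Px Py = Py ¬a

does≡true⇒ : {A : Set a} (A? : Dec A) → does A? ≡ true → A
does≡true⇒ (yes a) refl = a

x∉p⇒p-x≡p : ∀ {x} {p : Subset n} → x ∉ p → p ∖ x ≡ p
x∉p⇒p-x≡p {x = Fin.zero}  {inside  ∷ p} x∉p = contradiction here x∉p
x∉p⇒p-x≡p {x = Fin.zero}  {outside ∷ p} x∉p = cong (outside ∷_) (p─⊥≡p p)
x∉p⇒p-x≡p {x = Fin.suc x} {s ∷ p}       x∉p = cong (s ∷_) (x∉p⇒p-x≡p (x∉p ∘ there))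

x∈p⇒∣p∣≡suc∣p-x∣ : ∀ {x} {p : Subset n} → x ∈ p → ∣ p ∣ ≡ suc ∣ p ∖ x ∣
x∈p⇒∣p∣≡suc∣p-x∣ {p = _ ∷ p} here = cong (suc ∘ ∣_∣) (≡.sym (p─⊥≡p p))
x∈p⇒∣p∣≡suc∣p-x∣ {p = inside  ∷ p} (there x∈p) = cong suc (x∈p⇒∣p∣≡suc∣p-x∣ x∈p)
x∈p⇒∣p∣≡suc∣p-x∣ {p = outside ∷ p} (there x∈p) = x∈p⇒∣p∣≡suc∣p-x∣ x∈p

x∈p─q⇒x∉q : ∀ {x} (p q : Subset n) → x ∈ p ─ q → x ∉ q
x∈p─q⇒x∉q (_ ∷ p) (inside  ∷ q) (there x∈) (there x∈q) = x∈p─q⇒x∉q p q x∈ x∈q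
x∈p─q⇒x∉q (_ ∷ p) (outside ∷ q) (there x∈) (there x∈q) = x∈p─q⇒x∉q p q x∈ x∈q

p∩[q─r]≡[p∩q]─r : ∀ (p q r : Subset n) → p ∩ (q ─ r) ≡ (p ∩ q) ─ r
p∩[q─r]≡[p∩q]─r [] [] [] = refl
p∩[q─r]≡[p∩q]─r (x ∷ p) (y ∷ q) (outside ∷ r) = cong (_ ∷_) (p∩[q─r]≡[p∩q]─r p q r)
p∩[q─r]≡[p∩q]─r (inside  ∷ p) (y ∷ q) (inside ∷ r) = cong (_ ∷_) (p∩[q─r]≡[p∩q]─r p q r)
p∩[q─r]≡[p∩q]─r (outside ∷ p) (y ∷ q) (inside ∷ r) = cong (_ ∷_) (p∩[q─r]≡[p∩q]─r p q r)

nonempty⇒1≤∣p∣ : {p : Subset n} → Nonempty p → 1 ℕ.≤ ∣ p ∣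
nonempty⇒1≤∣p∣ (x , x∈p) = subst (1 ℕ.≤_) (≡.sym (x∈p⇒∣p∣≡suc∣p-x∣ x∈p)) (s≤s z≤n)

some : ∀ n {{_ : NonZero n}} → Fin n
some (suc n) = Fin.zero

≤-foldr-⊔ : (f : Fin n → ℕ) → ∀ i → f i ℕ.≤ Vector.foldr ℕ._⊔_ 0 f
≤-foldr-⊔ f Fin.zero    = ℕ.m≤m⊔n _ _
≤-foldr-⊔ f (Fin.suc i) = ℕ.≤-trans (≤-foldr-⊔ (f ∘ Fin.suc) i) (ℕ.m≤n⊔m (f Fin.zero) _)

-- Arithmetic in an ordered field.

module OrderedField {c ℓ₁ ℓ₂ : Level} (ℝ : CompleteOrderedField c ℓ₁ ℓ₂) where

  open CompleteOrderedField ℝ renaming (refl to ≈-refl)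
  open RingProperties ring
    using (-‿distribˡ-*; -‿involutive; -0#≈0#; [y-z]x≈yx-zx)
  open AbelianGroupProperties +-abelianGroup using () renaming (⁻¹-∙-comm to -‿+-comm)
  open SemiringSum semiring using (∑-distrib-+)
  open DecTotalOrderProperties decTotalOrder using (<⇒≱)
  open PartialOrderReasoning (DecTotalOrder.poset decTotalOrder)

  ≮⇒≥ : ∀ {x y} → ¬ (x < y) → y ≤ x
  ≮⇒≥ = NonStrictToStrict.≮⇒≥ _≈_ _≤_ sym _≟_ ≤-reflexive total

  ≰⇒> : ∀ {x y} → ¬ (x ≤ y) → y < x
  ≰⇒> = NonStrictToStrict.≰⇒> _≈_ _≤_ sym ≤-reflexive total

  +-monoʳ-≤ : ∀ z {x y} → x ≤ y → z + x ≤ z + y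
  +-monoʳ-≤ z x≤y = ≤-respˡ-≈ (+-comm _ z) (≤-respʳ-≈ (+-comm _ z) (+-monoˡ-≤ z x≤y))

  +-mono-≤ : ∀ {w x y z} → w ≤ x → y ≤ z → w + y ≤ x + z
  +-mono-≤ {x = x} {y} w≤x y≤z = ≤-trans (+-monoˡ-≤ y w≤x) (+-monoʳ-≤ x y≤z)

  x-y+y≈x : ∀ x y → x - y + y ≈ x
  x-y+y≈x x y = trans (+-assoc x (- y) y) (trans (+-congˡ (-‿inverseˡ y)) (+-identityʳ x))

  x+y-y≈x : ∀ x y → x + y - y ≈ x
  x+y-y≈x x y = trans (+-assoc x y (- y)) (trans (+-congˡ (-‿inverseʳ y)) (+-identityʳ x))

  x≤y⇒0≤y-x : ∀ {x y} → x ≤ y → 0# ≤ y - x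
  x≤y⇒0≤y-x {x} x≤y = ≤-respˡ-≈ (-‿inverseʳ x) (+-monoˡ-≤ (- x) x≤y)

  0≤y-x⇒x≤y : ∀ {x y} → 0# ≤ y - x → x ≤ y
  0≤y-x⇒x≤y {x} {y} p = ≤-respˡ-≈ (+-identityˡ x) (≤-respʳ-≈ (x-y+y≈x y x) (+-monoˡ-≤ x p))

  x+y≤z⇒x≤z-y : ∀ {x y z} → x + y ≤ z → x ≤ z - y
  x+y≤z⇒x≤z-y {x} {y} p = ≤-respˡ-≈ (x+y-y≈x x y) (+-monoˡ-≤ (- y) p)

  0≤y⇒x-y≤x : ∀ {x y} → 0# ≤ y → x - y ≤ x
  0≤y⇒x-y≤x {x} {y} 0≤y = begin
    x - y       ≈⟨ +-identityʳ _ ⟨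
    x - y + 0#  ≤⟨ +-monoʳ-≤ _ 0≤y ⟩
    x - y + y   ≈⟨ x-y+y≈x x y ⟩
    x           ∎

  *-monoˡ-≤ : ∀ {x y z} → 0# ≤ z → x ≤ y → x * z ≤ y * z
  *-monoˡ-≤ {x} {y} {z} 0≤z x≤y =
    0≤y-x⇒x≤y (≤-respʳ-≈ ([y-z]x≈yx-zx z y x) (*-nonNeg (x≤y⇒0≤y-x x≤y) 0≤z))

  *-monoʳ-≤ : ∀ {x y z} → 0# ≤ z → x ≤ y → z * x ≤ z * y
  *-monoʳ-≤ {z = z} 0≤z x≤y =
    ≤-respˡ-≈ (*-comm _ z) (≤-respʳ-≈ (*-comm _ z) (*-monoˡ-≤ 0≤z x≤y))

  0≤1 : 0# ≤ 1#
  0≤1 with total 0# 1#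
  ... | inj₁ 0≤1 = 0≤1
  ... | inj₂ 1≤0 = ≤-respʳ-≈ -1*-1≈1 (*-nonNeg 0≤-1 0≤-1)
    where
    0≤-1 : 0# ≤ - 1#
    0≤-1 = ≤-respʳ-≈ (+-identityˡ _) (x≤y⇒0≤y-x 1≤0)
    -1*-1≈1 : - 1# * - 1# ≈ 1#
    -1*-1≈1 = trans (sym (-‿distribˡ-* 1# (- 1#)))
      (trans (-‿cong (*-identityˡ (- 1#))) (-‿involutive 1#))

  0<1 : 0# < 1#
  0<1 = 0≤1 , 0≉1

  <-≤-trans : ∀ {x y z} → x < y → y ≤ z → x < z
  <-≤-trans = NonStrictToStrict.<-≤-trans _≈_ _≤_ sym ≤-trans antisym ≤-respʳ-≈

  -- Were the inverse at most 0, multiplying by `x` would give 1 ≤ 0.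
  0≤x⁻¹ : ∀ {x} → 0# < x → 0# ≤ x ⁻¹
  0≤x⁻¹ {x} (0≤x , 0≉x) with total 0# (x ⁻¹)
  ... | inj₁ 0≤x⁻¹ = 0≤x⁻¹
  ... | inj₂ x⁻¹≤0 = contradiction
    (≤-respˡ-≈ (*-inverseʳ (0≉x ∘ sym)) (≤-respʳ-≈ (zeroʳ x) (*-monoʳ-≤ 0≤x x⁻¹≤0)))
    (<⇒≱ 0<1)

  x*y⁻¹*y≈x : ∀ x {y} → 0# < y → x / y * y ≈ x
  x*y⁻¹*y≈x x (_ , 0≉y) = trans (*-assoc x _ _) (trans
    (*-congˡ (trans (*-comm _ _) (*-inverseʳ (0≉y ∘ sym)))) (*-identityʳ x))

  x*y*y⁻¹≈x : ∀ x {y} → 0# < y → x * y * y ⁻¹ ≈ x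
  x*y*y⁻¹≈x x (_ , 0≉y) =
    trans (*-assoc x _ _) (trans (*-congˡ (*-inverseʳ (0≉y ∘ sym))) (*-identityʳ x))

  x*y≤z⇒x≤z/y : ∀ {x y z} → 0# < y → x * y ≤ z → x ≤ z / y
  x*y≤z⇒x≤z/y 0<y xy≤z = ≤-respˡ-≈ (x*y*y⁻¹≈x _ 0<y) (*-monoˡ-≤ (0≤x⁻¹ 0<y) xy≤z)

  x≤z*y⇒x/y≤z : ∀ {x y z} → 0# < y → x ≤ z * y → x / y ≤ z
  x≤z*y⇒x/y≤z 0<y x≤zy = ≤-respʳ-≈ (x*y*y⁻¹≈x _ 0<y) (*-monoˡ-≤ (0≤x⁻¹ 0<y) x≤zy)

  x/y≤z⇒x≤z*y : ∀ {x y z} → 0# < y → x / y ≤ z → x ≤ z * y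
  x/y≤z⇒x≤z*y 0<y x/y≤z = ≤-respˡ-≈ (x*y⁻¹*y≈x _ 0<y) (*-monoˡ-≤ (proj₁ 0<y) x/y≤z)

  *-cancelʳ-≤ : ∀ {x y z} → 0# < z → x * z ≤ y * z → x ≤ y
  *-cancelʳ-≤ 0<z xz≤yz = ≤-respʳ-≈ (x*y*y⁻¹≈x _ 0<z) (x*y≤z⇒x≤z/y 0<z xz≤yz)

  *-pos : ∀ {x y} → 0# < x → 0# < y → 0# < x * y
  *-pos {x} {y} (0≤x , 0≉x) 0<y = *-nonNeg 0≤x (proj₁ 0<y) , λ 0≈xy →
    0≉x (sym (trans (sym (x*y*y⁻¹≈x x 0<y)) (trans (*-congʳ (sym 0≈xy)) (zeroˡ _))))

  0≤fromℕ : ∀ k → 0# ≤ fromℕ k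
  0≤fromℕ zero    = ≤-refl
  0≤fromℕ (suc k) = ≤-respˡ-≈ (+-identityˡ 0#) (+-mono-≤ 0≤1 (0≤fromℕ k))

  fromℕ-mono : ∀ {j k} → j ℕ.≤ k → fromℕ j ≤ fromℕ k
  fromℕ-mono {k = k} z≤n = 0≤fromℕ k
  fromℕ-mono (s≤s j≤k) = +-monoʳ-≤ 1# (fromℕ-mono j≤k)

  0<fromℕ : ∀ {k} → 1 ℕ.≤ k → 0# < fromℕ k
  0<fromℕ 1≤k = <-≤-trans 0<1 (≤-respˡ-≈ (+-identityʳ 1#) (fromℕ-mono {1} 1≤k))

  fromℕ-suc-* : ∀ k x → fromℕ (suc k) * x ≈ x + fromℕ k * x
  fromℕ-suc-* k x = trans (distribʳ x 1# (fromℕ k)) (+-congʳ (*-identityˡ x))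

  -- Finite sums and maxima over subsets.

  sum-mono-≤ : {f g : Fin n → Carrier} → (∀ i → f i ≤ g i) → sum f ≤ sum g
  sum-mono-≤ {zero}  f≤g = ≤-refl
  sum-mono-≤ {suc n} f≤g = +-mono-≤ (f≤g Fin.zero) (sum-mono-≤ (f≤g ∘ Fin.suc))

  0≤sum : {f : Fin n → Carrier} → (∀ i → 0# ≤ f i) → 0# ≤ sum f
  0≤sum {zero}  0≤f = ≤-refl
  0≤sum {suc n} 0≤f =
    ≤-respˡ-≈ (+-identityˡ 0#) (+-mono-≤ (0≤f Fin.zero) (0≤sum (0≤f ∘ Fin.suc)))

  sum-‿- : (f : Fin n → Carrier) → sum (λ i → - f i) ≈ - sum f
  sum-‿- {zero}  f = sym -0#≈0#
  sum-‿- {suc n} f = trans (+-congˡ (sum-‿- (f ∘ Fin.suc))) (-‿+-comm _ _)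

  sum-distrib-‿- : (f g : Fin n → Carrier) → sum (λ i → f i - g i) ≈ sum f - sum g
  sum-distrib-‿- f g = trans (∑-distrib-+ f (λ i → - g i)) (+-congˡ (sum-‿- g))

  -- The counting half of the later double counting. Membership decisions compute on the head of the
  -- vector, so induction on `T` suffices.
  sum-indicator : ∀ (T : Subset n) x →
                  sum (λ v → if does (v ∈? T) then x else 0#) ≈ fromℕ ∣ T ∣ * x
  sum-indicator []            x = sym (zeroˡ x)
  sum-indicator (inside  ∷ T) x =
    trans (+-congˡ (sum-indicator T x)) (sym (fromℕ-suc-* ∣ T ∣ x))
  sum-indicator (outside ∷ T) x = trans (+-congˡ (sum-indicator T x)) (+-identityˡ _)

  -- The larger of two maxima: one over the sets containing the first element, one over the sets
  -- avoiding it.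
  argmax : (g : Subset n → Carrier) → ∃ λ S → ∀ T → g T ≤ g S
  argmax {zero}  g = [] , λ { [] → ≤-refl }
  argmax {suc n} g with argmax (g ∘ (inside ∷_)) | argmax (g ∘ (outside ∷_))
  ... | S , S-max | T , T-max with total (g (inside ∷ S)) (g (outside ∷ T))
  ...   | inj₁ S≤T = outside ∷ T ,
    λ { (inside ∷ U) → ≤-trans (S-max U) S≤T ; (outside ∷ U) → T-max U }
  ...   | inj₂ T≤S = inside ∷ S ,
    λ { (inside ∷ U) → S-max U ; (outside ∷ U) → ≤-trans (T-max U) T≤S }

  open Logarithm ℝ

  -- The integer p is the rational p / 1, encoded with `q′` = 0, hence a member of the set whose
  -- supremum is the logarithm.
  b^p≤y⇒p≤log : ∀ {b y} (1<b : 1# < b) (1≤y : 1# ≤ y) p → b ^ p ≤ y → fromℕ p ≤ log b y 1<b 1≤y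
  b^p≤y⇒p≤log {b} {y} 1<b 1≤y p bᵖ≤y = proj₁ (proj₂ (log-supremum b y 1<b 1≤y))
    (p , 0 , p≈p/1 , ≤-respʳ-≈ (sym (*-identityʳ y)) bᵖ≤y)
    where
    p≈p/1 : fromℕ p ≈ fromℕ p / fromℕ 1
    p≈p/1 = trans (sym (x*y*y⁻¹≈x _ (0<fromℕ {1} (s≤s z≤n))))
      (*-congʳ (trans (*-congˡ (+-identityʳ 1#)) (*-identityʳ _)))

-- Marginals of `F`, edge by edge.

module Marginals
  {c ℓ₁ ℓ₂ : Level} (ℝ : CompleteOrderedField c ℓ₁ ℓ₂)
  {n : ℕ} (H : DensestSubhypergraph.Hypergraph ℝ n) where

  open CompleteOrderedField ℝ renaming (refl to ≈-refl)
  open OrderedField ℝ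
  open DensestSubhypergraph ℝ
  open Hypergraph H
  open SemiringSum semiring
    using (∑-comm; sum-cong-≋; sum-replicate-zero; *-distribˡ-sum)
  open PartialOrderReasoning (DecTotalOrder.poset decTotalOrder)

  -- Repeats the position at which `F` evaluates `weight`, so that `F H S` unfolds to the sum of
  -- `value e S` over the edges.
  index : ∀ e → Subset n → Fin (suc ∣ edge e ∣)
  index e S = Fin.fromℕ< (s≤s (∣p∩q∣≤∣p∣ (edge e) S))

  value : Fin size → Subset n → Carrier
  value e S = weight e (index e S)

  toℕ-index : ∀ e S → toℕ (index e S) ≡ ∣ edge e ∩ S ∣
  toℕ-index e S = toℕ-fromℕ< _

  value-∉ : ∀ e S {v} → v ∉ edge e → value e (S ∖ v) ≡ value e S
  value-∉ e S {v} v∉e = cong (weight e) (toℕ-injective (≡.trans (toℕ-index e (S ∖ v))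
    (≡.trans (cong ∣_∣ eq) (≡.sym (toℕ-index e S)))))
    where
    eq : edge e ∩ (S ∖ v) ≡ edge e ∩ S
    eq = ≡.trans (p∩[q─r]≡[p∩q]─r (edge e) S _)
      (x∉p⇒p-x≡p (v∉e ∘ proj₁ ∘ x∈p∩q⁻ (edge e) S))

  ∣e∩S∣≡suc : ∀ e {S v} → v ∈ edge e → v ∈ S → ∣ edge e ∩ S ∣ ≡ suc ∣ edge e ∩ (S ∖ v) ∣
  ∣e∩S∣≡suc e {S} v∈e v∈S = ≡.trans (x∈p⇒∣p∣≡suc∣p-x∣ (x∈p∩q⁺ (v∈e , v∈S)))
    (cong (suc ∘ ∣_∣) (≡.sym (p∩[q─r]≡[p∩q]─r (edge e) S _)))

  index-suc : ∀ e {S v} → v ∈ edge e → v ∈ S → toℕ (index e S) ≡ suc (toℕ (index e (S ∖ v)))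
  index-suc e {S} {v} v∈e v∈S = ≡.trans (toℕ-index e S)
    (≡.trans (∣e∩S∣≡suc e v∈e v∈S) (cong suc (≡.sym (toℕ-index e (S ∖ v)))))

  value-marginal-∉ : ∀ e S {v} → v ∉ edge e → value e S - value e (S ∖ v) ≈ 0#
  value-marginal-∉ e S v∉e =
    trans (+-congˡ (-‿cong (reflexive (value-∉ e S v∉e)))) (-‿inverseʳ _)

  F-marginal : ∀ S v → sum (λ e → value e S - value e (S ∖ v)) ≈ F H S - F H (S ∖ v)
  F-marginal S v = sum-distrib-‿- (λ e → value e S) (λ e → value e (S ∖ v))

  0≤F : ∀ S → 0# ≤ F H S
  0≤F S = 0≤sum λ e → weight-nonNeg e (index e S)

  0<∣S∣ : ∀ {S : Subset n} → Nonempty S → 0# < fromℕ ∣ S ∣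
  0<∣S∣ ne = 0<fromℕ (nonempty⇒1≤∣p∣ ne)

  density*∣S∣≈F : ∀ {S} → Nonempty S → density H S * fromℕ ∣ S ∣ ≈ F H S
  density*∣S∣≈F ne = x*y⁻¹*y≈x _ (0<∣S∣ ne)

  0≤density : ∀ {S} → Nonempty S → 0# ≤ density H S
  0≤density ne = *-nonNeg (0≤F _) (0≤x⁻¹ (0<∣S∣ ne))

  ∣e∣≤rank : ∀ e → ∣ edge e ∣ ℕ.≤ rank H
  ∣e∣≤rank = ≤-foldr-⊔ (λ e → ∣ edge e ∣)

  0<rank : 0# < fromℕ (rank H)
  0<rank = <-≤-trans (0<∣S∣ (edge-nonempty e)) (fromℕ-mono (∣e∣≤rank e))
    where e = some size

  -- Double counting: exchange the sums over vertices and edges, then bound each edge separately.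
  -- Later `θ` is the removal threshold and `T` the set of survivors.
  ∑-marginals≤rank*F : ∀ S T θ → (∀ v → v ∈ T → θ ≤ F H S - F H (S ∖ v)) →
                       fromℕ ∣ T ∣ * θ ≤ fromℕ (rank H) * F H S
  ∑-marginals≤rank*F S T θ θ≤ = begin
    fromℕ ∣ T ∣ * θ                                     ≈⟨ sum-indicator T θ ⟨
    sum (λ v → if does (v ∈? T) then θ else 0#)         ≤⟨ sum-mono-≤ by-vertex ⟩
    sum (λ v → sum (λ e → contribution e v))            ≈⟨ ∑-comm (λ v e → contribution e v) ⟩
    sum (λ e → sum (contribution e))                    ≤⟨ sum-mono-≤ by-edge ⟩
    sum (λ e → fromℕ (rank H) * value e S)              ≈⟨ *-distribˡ-sum (fromℕ (rank H)) (λ e → value e S) ⟨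
    fromℕ (rank H) * F H S                              ∎
    where
    contribution : Fin size → Fin n → Carrier
    contribution e v = if does (v ∈? T) then value e S - value e (S ∖ v) else 0#

    by-vertex : ∀ v → (if does (v ∈? T) then θ else 0#) ≤ sum (λ e → contribution e v)
    by-vertex v with v ∈? T
    ... | yes v∈T = ≤-respʳ-≈ (sym (F-marginal S v)) (θ≤ v v∈T)
    ... | no  v∉T = ≤-reflexive (sym (sum-replicate-zero size))

    contribution≤ : ∀ e v → contribution e v ≤ (if does (v ∈? edge e ∩ T) then value e S else 0#)
    contribution≤ e v with v ∈? T | v ∈? edge e ∩ T
    -- Nonnegativity of the weights lets the subtracted value be dropped.
    ... | yes v∈T | yes _     = 0≤y⇒x-y≤x (weight-nonNeg e _)
    -- A vertex of `T` missing from e ∩ T lies outside e, and its deletion leaves the value of e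
    -- unchanged.
    ... | yes v∈T | no  v∉e∩T =
      ≤-reflexive (value-marginal-∉ e S λ v∈e → v∉e∩T (x∈p∩q⁺ (v∈e , v∈T)))
    ... | no  v∉T | yes _     = weight-nonNeg e _
    ... | no  v∉T | no  _     = ≤-refl

    by-edge : ∀ e → sum (contribution e) ≤ fromℕ (rank H) * value e S
    by-edge e = begin
      sum (contribution e)                                          ≤⟨ sum-mono-≤ (contribution≤ e) ⟩
      sum (λ v → if does (v ∈? edge e ∩ T) then value e S else 0#)  ≈⟨ sum-indicator (edge e ∩ T) (value e S) ⟩
      fromℕ ∣ edge e ∩ T ∣ * value e S                              ≤⟨ *-monoˡ-≤ (weight-nonNeg e _) (fromℕ-mono (ℕ.≤-trans (∣p∩q∣≤∣p∣ (edge e) T) (∣e∣≤rank e))) ⟩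
      fromℕ (rank H) * value e S                                    ∎

  -- Convexity compares neighbouring unit increments; chaining the comparisons from `i` up to `j`
  -- gives the general case. Recursion on `≤′` lowers the upper end by one each time.
  convex⇒increments-mono : ∀ {m} {f : Fin (suc m) → Carrier} → Convex f → ∀ {i i′ j j′} →
    toℕ i′ ≡ suc (toℕ i) → toℕ j′ ≡ suc (toℕ j) → toℕ i ℕ.≤ toℕ j → f i′ - f i ≤ f j′ - f j
  convex⇒increments-mono {m} {f} convex {i} {i′} i′≡ j′≡ i≤j = go j′≡ refl (ℕ.≤⇒≤′ i≤j)
    where
    go : ∀ {k j j′} → toℕ j′ ≡ suc (toℕ j) → toℕ j ≡ k → toℕ i ℕ.≤′ k → f i′ - f i ≤ f j′ - f j
    go {j = j} {j′} j′≡ j≡i ℕ.≤′-refl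
      with refl ← toℕ-injective {i = j} {i} j≡i
      with refl ← toℕ-injective {i = j′} {i′} (≡.trans j′≡ (≡.sym i′≡)) = ≤-refl
    -- The predecessor of `Fin.suc j` within the same `Fin` type is `inject₁ j`.
    go {j = Fin.suc j} {j′} j′≡ j≡1+k (ℕ.≤′-step i≤k) = ≤-trans
      (go {j = inject₁ j} {Fin.suc j} (cong suc (≡.sym (toℕ-inject₁ j)))
        (≡.trans (toℕ-inject₁ j) (ℕ.suc-injective j≡1+k)) i≤k)
      (convex _ _ _ (cong suc (≡.sym (toℕ-inject₁ j))) j′≡)

  -- Supermodularity of `F`.

  module _ (convex : ∀ e → Convex (weight e)) where

    -- For an edge containing `v`, both marginals are unit increments of the same convex function,
    -- and the one for `S` sits at least as far to the right because e ∩ T ⊆ e ∩ S.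
    marginal-mono : ∀ {S T v} → T ⊆ S → v ∈ T → F H T - F H (T ∖ v) ≤ F H S - F H (S ∖ v)
    marginal-mono {S} {T} {v} T⊆S v∈T =
      ≤-respˡ-≈ (F-marginal T v) (≤-respʳ-≈ (F-marginal S v) (sum-mono-≤ edgewise))
      where
      edgewise : ∀ e → value e T - value e (T ∖ v) ≤ value e S - value e (S ∖ v)
      edgewise e with v ∈? edge e
      ... | no  v∉e =
        ≤-reflexive (trans (value-marginal-∉ e T v∉e) (sym (value-marginal-∉ e S v∉e)))
      ... | yes v∈e = convex⇒increments-mono (convex e)
        (index-suc e v∈e v∈T) (index-suc e v∈e (T⊆S v∈T)) (ℕ.s≤s⁻¹
          (≡.subst₂ ℕ._≤_ (index-suc e v∈e v∈T) (index-suc e v∈e (T⊆S v∈T))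
            (≡.subst₂ ℕ._≤_ (≡.sym (toℕ-index e T)) (≡.sym (toℕ-index e S))
              (p⊆q⇒∣p∣≤∣q∣ λ x∈ → let x∈e , x∈T = x∈p∩q⁻ (edge e) T x∈ in
                x∈p∩q⁺ (x∈e , T⊆S x∈T)))))

  -- Marginals inside an optimal set.

  module _ (weight₀≈0 : ∀ e → weight e Fin.zero ≈ 0#) where

    F⊥≈0 : F H ⊥ ≈ 0#
    F⊥≈0 = trans (sum-cong-≋ value⊥≈0) (sum-replicate-zero size)
      where
      value⊥≈0 : ∀ e → value e ⊥ ≈ 0#
      value⊥≈0 e = trans (reflexive (cong (weight e) (toℕ-injective
        (≡.trans (toℕ-index e ⊥) (≡.trans (cong ∣_∣ (∩-zeroʳ (edge e))) (∣⊥∣≡0 n))))))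
        (weight₀≈0 e)

    -- Clears the denominator in optimality and so includes the empty set, where density is
    -- meaningless but F(∅) = 0. Deleting the only vertex of a singleton leads to that case.
    F≤density*∣S∣ : ∀ {T} → Optimal H T → ∀ S → F H S ≤ density H T * fromℕ ∣ S ∣
    F≤density*∣S∣ {T} (T-nonempty , T-max) S with nonempty? S
    ... | yes ne = x/y≤z⇒x≤z*y (0<∣S∣ ne) (T-max S ne)
    ... | no  ¬ne rewrite Empty-unique ¬ne =
      ≤-respˡ-≈ (sym F⊥≈0) (*-nonNeg (0≤density T-nonempty) (0≤fromℕ ∣ ⊥ {n} ∣))

    -- With ρ the optimal density, F(T) = ρ|T| while F(T∖v) ≤ ρ(|T| - 1), so the difference is at
    -- least ρ.
    optimal-marginal : ∀ {T v} → Optimal H T → v ∈ T → density H T ≤ F H T - F H (T ∖ v)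
    optimal-marginal {T} {v} opt@(T-nonempty , _) v∈T = x+y≤z⇒x≤z-y (begin
      ρ + F H (T ∖ v)                    ≤⟨ +-monoʳ-≤ ρ (F≤density*∣S∣ opt (T ∖ v)) ⟩
      ρ + ρ * fromℕ ∣ T ∖ v ∣            ≈⟨ +-congˡ (*-comm ρ _) ⟩
      ρ + fromℕ ∣ T ∖ v ∣ * ρ            ≈⟨ fromℕ-suc-* ∣ T ∖ v ∣ ρ ⟨
      fromℕ (suc ∣ T ∖ v ∣) * ρ          ≡⟨ cong (λ k → fromℕ k * ρ) (x∈p⇒∣p∣≡suc∣p-x∣ v∈T) ⟨
      fromℕ ∣ T ∣ * ρ                    ≈⟨ *-comm _ ρ ⟩
      ρ * fromℕ ∣ T ∣                    ≈⟨ density*∣S∣≈F T-nonempty ⟩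
      F H T                              ∎)
      where ρ = density H T

  -- Replacing the empty set by V turns an unrestricted maximum into one over nonempty sets.
  optimal-exists : ∃ (Optimal H)
  optimal-exists with argmax (density H ∘ orV)
    where
    orV : Subset n → Subset n
    orV S = if does (nonempty? S) then S else ⊤
  ... | S , S-max =
      (if does (nonempty? S) then S else ⊤)
    , if-does-elim Nonempty (nonempty? S) (λ ne → ne) (λ _ → some n , ∈⊤)
    , λ T T-nonempty → subst (λ U → density H U ≤ _)
        (if-does-elim (_≡ T) (nonempty? T) (λ _ → refl) (contradiction T-nonempty)) (S-max T)

-- Analysis of the peeling loop.

module Peeling
  {c ℓ₁ ℓ₂ : Level} (ℝ : CompleteOrderedField c ℓ₁ ℓ₂)
  {n : ℕ} (H : DensestSubhypergraph.Hypergraph ℝ n)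
  {ε : CompleteOrderedField.Carrier ℝ}
  (0<ε : CompleteOrderedField._<_ ℝ (CompleteOrderedField.0# ℝ) ε) where

  open CompleteOrderedField ℝ renaming (refl to ≈-refl)
  open OrderedField ℝ
  open Logarithm ℝ using (log; 1<1+x)
  open DensestSubhypergraph ℝ
  open GDSH-Para H ε
  open Marginals ℝ H
  open DecTotalOrderProperties decTotalOrder using (<⇒≱)
  open SemiringSolver commutativeSemiring using (solve; _:*_; _:=_)
  open PartialOrderReasoning (DecTotalOrder.poset decTotalOrder)

  b r : Carrier
  b = 1# + ε
  r = fromℕ (rank H)

  1<b : 1# < b
  1<b = 1<1+x 0<ε

  0≤b : 0# ≤ b
  0≤b = ≤-trans 0≤1 (proj₁ 1<b)

  ∈Δ⇒removable : ∀ {S v} → v ∈ Δ S → Removable S v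
  ∈Δ⇒removable {S} {v} v∈Δ = proj₂ (does≡true⇒ (v ∈? S ×-dec removable? S v)
    (≡.trans (≡.sym (lookup∘tabulate _ v)) ([]=⇒lookup v∈Δ)))

  removable⇒∈Δ : ∀ {S v} → v ∈ S → Removable S v → v ∈ Δ S
  removable⇒∈Δ {S} {v} v∈S rem = lookup⇒[]= v (Δ S)
    (≡.trans (lookup∘tabulate _ v) (dec-true (v ∈? S ×-dec removable? S v) (v∈S , rem)))

  survivor⇒threshold< : ∀ {S v} → v ∈ S ─ Δ S → r * b * density H S < F H S - F H (S ∖ v)
  survivor⇒threshold< {S} v∈ = ≰⇒> λ rem →
    x∈p─q⇒x∉q S (Δ S) v∈ (removable⇒∈Δ (p─q⊆p S (Δ S) v∈) rem)

  -- A survivor would have a marginal strictly above a nonnegative threshold, yet no marginal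
  -- exceeds F(S) = 0. This covers the case in which F(S) cannot be cancelled.
  F≈0⇒all-removed : ∀ {S} → Nonempty S → F H S ≈ 0# → S ─ Δ S ≡ ⊥
  F≈0⇒all-removed {S} ne F≈0 = Empty-unique λ (v , v∈) → <⇒≱ (survivor⇒threshold< v∈) (begin
    F H S - F H (S ∖ v)  ≤⟨ 0≤y⇒x-y≤x (0≤F (S ∖ v)) ⟩
    F H S                ≈⟨ F≈0 ⟩
    0#                   ≤⟨ *-nonNeg (*-nonNeg (proj₁ 0<rank) 0≤b) (0≤density ne) ⟩
    r * b * density H S  ∎)

  -- The survivors' marginals each exceed r b F(S)/|S| and total at most r F(S), which bounds their
  -- number by |S|/b.
  b*∣S─Δ∣≤∣S∣ : ∀ S → Nonempty S → b * fromℕ ∣ S ─ Δ S ∣ ≤ fromℕ ∣ S ∣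
  b*∣S─Δ∣≤∣S∣ S ne with F H S ≟ 0#
  ... | yes F≈0 rewrite F≈0⇒all-removed ne F≈0 | ∣⊥∣≡0 n =
    ≤-respˡ-≈ (sym (zeroʳ b)) (0≤fromℕ ∣ S ∣)
  -- Both sides are multiplied by the positive number r F(S), with F(S) rewritten as density times
  -- |S| to expose the threshold.
  ... | no  F≉0 = *-cancelʳ-≤ (*-pos 0<rank (0≤F S , F≉0 ∘ sym)) (begin
    b * t * (r * F H S)              ≈⟨ *-congˡ (*-congˡ (density*∣S∣≈F ne)) ⟨
    b * t * (r * (density H S * s))  ≈⟨ solve 5 (λ b t r d s → b :* t :* (r :* (d :* s)) := t :* (r :* b :* d) :* s) ≈-refl b t r (density H S) s ⟩
    t * (r * b * density H S) * s    ≤⟨ *-monoˡ-≤ (0≤fromℕ ∣ S ∣) (∑-marginals≤rank*F S (S ─ Δ S) _ λ v v∈ → proj₁ (survivor⇒threshold< v∈)) ⟩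
    r * F H S * s                    ≈⟨ *-comm _ s ⟩
    s * (r * F H S)                  ∎)
    where
    s = fromℕ ∣ S ∣
    t = fromℕ ∣ S ─ Δ S ∣

  ∣S─Δ∣<∣S∣ : ∀ S → Nonempty S → ∣ S ─ Δ S ∣ ℕ.< ∣ S ∣
  ∣S─Δ∣<∣S∣ S ne = ℕ.≰⇒> λ s≤t → <⇒≱ 1<b (*-cancelʳ-≤ (0<∣S∣ ne) (begin
    b * fromℕ ∣ S ∣        ≤⟨ *-monoʳ-≤ 0≤b (fromℕ-mono s≤t) ⟩
    b * fromℕ ∣ S ─ Δ S ∣  ≤⟨ b*∣S─Δ∣≤∣S∣ S ne ⟩
    fromℕ ∣ S ∣            ≈⟨ *-identityˡ _ ⟨
    1# * fromℕ ∣ S ∣       ∎))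

  -- Termination and the number of iterations.

  terminates : ∀ S S′ → ∃₂ λ t R → Run S S′ t R
  terminates S S′ = go S S′ (<-wellFounded ∣ S ∣)
    where
    go : ∀ S S′ → Acc ℕ._<_ ∣ S ∣ → ∃₂ λ t R → Run S S′ t R
    go S S′ (acc rs) with nonempty? S
    ... | no  empty = 0 , S′ , exit empty
    ... | yes ne    with go (S ─ Δ S) (best (S ─ Δ S) S′) (rs (∣S─Δ∣<∣S∣ S ne))
    ...   | t , R , run = suc t , R , iter ne run

  -- The exponent is one less than the number of iterations: the last iteration still starts with at
  -- least one vertex, and each earlier one shrinks the set by the factor `b`.
  b^t≤∣S∣ : ∀ {S S′ t R} → Run S S′ (suc t) R → b ^ t ≤ fromℕ ∣ S ∣
  b^t≤∣S∣ {t = zero} (iter ne _) =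
    ≤-respˡ-≈ (+-identityʳ 1#) (fromℕ-mono {1} (nonempty⇒1≤∣p∣ ne))
  b^t≤∣S∣ {S} {t = suc t} (iter ne run) =
    ≤-trans (*-monoʳ-≤ 0≤b (b^t≤∣S∣ run)) (b*∣S─Δ∣≤∣S∣ S ne)

  -- The count is at most 1 + log y, and b ≤ y makes the logarithm at least 1, so doubling it
  -- absorbs the additive 1. A separate bound `y` allows the logarithm to be taken of n itself when
  -- S = V.
  t≤2log : ∀ {S S′ t R y} → Run S S′ t R → (1≤y : 1# ≤ y) → fromℕ ∣ S ∣ ≤ y → b ≤ y →
           fromℕ t ≤ (1# + 1#) * log b y 1<b 1≤y
  t≤2log {t = t} {y = y} run 1≤y ∣S∣≤y b≤y = ≤-trans (t≤1+l run) (begin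
    1# + l          ≤⟨ +-monoˡ-≤ l 1≤l ⟩
    l + l           ≈⟨ +-cong (*-identityˡ l) (*-identityˡ l) ⟨
    1# * l + 1# * l ≈⟨ distribʳ l 1# 1# ⟨
    (1# + 1#) * l   ∎)
    where
    l = log b y 1<b 1≤y
    1≤l : 1# ≤ l
    1≤l = ≤-respˡ-≈ (+-identityʳ 1#)
      (b^p≤y⇒p≤log 1<b 1≤y 1 (≤-respˡ-≈ (sym (*-identityʳ b)) b≤y))
    t≤1+l : ∀ {S′ t R} → Run _ S′ t R → fromℕ t ≤ 1# + l
    -- No iterations: it is enough that the right-hand side is nonnegative.
    t≤1+l (exit _)           = ≤-respˡ-≈ (+-identityʳ 0#) (+-mono-≤ 0≤1 (≤-trans 0≤1 1≤l))
    t≤1+l run@(iter {t = t} _ _) =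
      +-monoʳ-≤ 1# (b^p≤y⇒p≤log 1<b 1≤y t (≤-trans (b^t≤∣S∣ run) ∣S∣≤y))

  -- The approximation ratio.

  best-elim : ∀ {ℓ} (P : Subset n → Set ℓ) {S S′} →
              (Nonempty S × density H S′ < density H S → P S) →
              (¬ (Nonempty S × density H S′ < density H S) → P S′) → P (best S S′)
  best-elim P {S} {S′} = if-does-elim P (nonempty? S ×-dec (density H S′ <? density H S))

  best-nonempty : ∀ {S S′} → Nonempty S′ → Nonempty (best S S′)
  best-nonempty ne′ = best-elim Nonempty proj₁ (λ _ → ne′)

  density≤bestʳ : ∀ S S′ → density H S′ ≤ density H (best S S′)
  density≤bestʳ S S′ =
    best-elim (λ R → density H S′ ≤ density H R) (proj₁ ∘ proj₂) (λ _ → ≤-refl)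

  density≤bestˡ : ∀ {S} S′ → Nonempty S → density H S ≤ density H (best S S′)
  density≤bestˡ {S} S′ ne =
    best-elim (λ R → density H S ≤ density H R) (λ _ → ≤-refl) (λ ¬p → ≮⇒≥ (¬p ∘ (ne ,_)))

  run-nonempty : ∀ {S S′ t R} → Run S S′ t R → Nonempty S′ → Nonempty R
  run-nonempty (exit _)     ne′ = ne′
  run-nonempty (iter _ run) ne′ = run-nonempty run (best-nonempty ne′)

  run-density : ∀ {S S′ t R} → Run S S′ t R → density H S′ ≤ density H R
  run-density (exit _)          = ≤-refl
  run-density (iter {S} {S′} _ run) = ≤-trans (density≤bestʳ (S ─ Δ S) S′) (run-density run)

  -- Induction along the run with two invariants: `T` is still contained in `S`, and the recorded
  -- set is at least as dense as `S`. The second is guarded by nonemptiness because the density of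
  -- the empty set is meaningless.
  run-approximates :
    (∀ e → Convex (Hypergraph.weight H e)) → (∀ e → Hypergraph.weight H e Fin.zero ≈ 0#) →
    ∀ {T S S′ t R} → Optimal H T → T ⊆ S → (Nonempty S → density H S ≤ density H S′) →
    Run S S′ t R → density H T ≤ r * b * density H R
  -- The loop cannot exit while `S` contains the nonempty set `T`.
  run-approximates convex weight₀≈0 ((v , v∈T) , _) T⊆S S≤S′ (exit empty) =
    contradiction (v , T⊆S v∈T) empty
  run-approximates convex weight₀≈0 {T} {S} {S′} {R = R} opt T⊆S S≤S′ run@(iter ne run′)
    with nonempty? (T ∩ Δ S)
  -- No vertex of `T` is deleted in this round, so both invariants pass to the next state.
  ... | no  disjoint = run-approximates convex weight₀≈0 opt
    (λ x∈T → x∈p∧x∉q⇒x∈p─q (T⊆S x∈T) λ x∈Δ → disjoint (_ , x∈p∩q⁺ (x∈T , x∈Δ)))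
    (density≤bestˡ S′) run′
  -- This is the first round to delete from `T`; the deleted vertex links the optimal density to
  -- that of `S`, and the recorded density never drops afterwards.
  ... | yes (v , v∈T∩Δ) with x∈p∩q⁻ T (Δ S) v∈T∩Δ
  ...   | v∈T , v∈Δ = begin
    density H T          ≤⟨ optimal-marginal weight₀≈0 opt v∈T ⟩
    F H T - F H (T ∖ v)  ≤⟨ marginal-mono convex T⊆S v∈T ⟩
    F H S - F H (S ∖ v)  ≤⟨ ∈Δ⇒removable v∈Δ ⟩
    r * b * density H S  ≤⟨ *-monoʳ-≤ (*-nonNeg (proj₁ 0<rank) 0≤b) (≤-trans (S≤S′ ne) (run-density run)) ⟩
    r * b * density H R  ∎

-- The O-bound is read as n tending to infinity for fixed `ε`: the constant `C` is chosen before `ε`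
-- and is thus absolute, while `n₀` may depend on `ε` but not on the hypergraph.
theorem5 : ∀ {c ℓ₁ ℓ₂ : Level} (ℝ : CompleteOrderedField c ℓ₁ ℓ₂) →
    let open CompleteOrderedField ℝ
        open Logarithm ℝ
        open DensestSubhypergraph ℝ
    in
    ∃[ C ] ∀ (ε : Carrier) (0<ε : 0# < ε) → ∃[ n₀ ]
    ∀ {n : ℕ} (H : Hypergraph n) →
    let open Hypergraph H
        open GDSH-Para H ε
    in
    (∀ e → NonDecreasing (weight e)) →
    (∀ e → Convex (weight e)) →
    (∀ e → weight e Fin.zero ≈ 0#) →
    ∃[ S′ ] ∃[ t ] (Returns S′ After t)
      × Nonempty S′
      × (∃[ S⋆ ] Optimal H S⋆
           × 1# / (fromℕ (rank H) * (1# + ε)) * density H S⋆ ≤ density H S′)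
      × (n₀ ℕ.≤ n →
           fromℕ t ≤ C * log (1# + ε) (fromℕ n) (1<1+x 0<ε) (1≤fromℕ n))
-- The Archimedean property supplies `n₀` at least 1 + ε, so n ≥ n₀ makes the logarithm of n at
-- least 1 and the factor 2 suffices.
theorem5 ℝ = 1# + 1# , λ ε 0<ε → proj₁ (archimedean (1# + ε)) , λ {n} H _ convex weight₀≈0 →
  let open Hypergraph H using (vertices-nonZero)
      open Marginals ℝ H
      open Peeling ℝ H 0<ε
      t , R , run = terminates ⊤ ⊤
      T , T-optimal = optimal-exists
      0<rb : 0# < r * b
      0<rb = *-pos 0<rank (<-≤-trans 0<1 (proj₁ 1<b))
      1≤n = 1≤fromℕ n
  in R , t , run , run-nonempty run (some n , ∈⊤)
   , (T , T-optimal , (begin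
       1# / (r * b) * density H T  ≈⟨ trans (*-congʳ (*-identityˡ _)) (*-comm _ _) ⟩
       density H T / (r * b)       ≤⟨ x≤z*y⇒x/y≤z 0<rb (≤-respʳ-≈ (*-comm _ _)
                                        -- Initially S = S′ = V, so both invariants hold trivially.
                                        (run-approximates convex weight₀≈0 T-optimal ⊆⊤ (λ _ → ≤-refl) run)) ⟩
       density H R                 ∎))
   , λ n₀≤n → t≤2log run 1≤n (≤-reflexive (reflexive (cong fromℕ (∣⊤∣≡n n))))
       (≤-trans (proj₂ (archimedean b)) (fromℕ-mono n₀≤n))
  where
  open CompleteOrderedField ℝ
  open OrderedField ℝ
  open Logarithm ℝ
  open DensestSubhypergraph ℝ
  open PartialOrderReasoning (DecTotalOrder.poset decTotalOrder)
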